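{- Let $p$ be a prime, let $d, w_1, w_2 \in \mathbb{N}$, let $\chi$ be a Dirichlet character with conductor $d$ (with values in $\mathbb{C}_p$), and let $\xi \in T_p$. For all $n \in \mathbb{Z}_+$, $m \in \mathbb{N}$ and all $x, y\in\mathbb{C}_p$, $$\sum_{j=0}^{n}\binom{n}{j}w_2^{j} w_1^{n-j-1}B_{n-j,\chi,\xi^{w_1}}^{(m)}(w_2x)\sum_{k=0}^{j}\binom{j}{k}T_{k,\chi,\xi^{w_2}}(w_1d-1)\,B_{j-k,\chi,\xi^{w_2}}^{(m-1)}(w_1y)$$ $$=\sum_{j=0}^{n}\binom{n}{j}w_1^{j} w_2^{n-j-1}B_{n-j,\chi,\xi^{w_2}}^{(m)}(w_1x)\sum_{k=0}^{j}\binom{j}{k}T_{k,\chi,\xi^{w_1}}(w_2d-1)\,B_{j-k,\chi,\xi^{w_1}}^{(m-1)}(w_2y).$$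
   Context: $\mathbb{N}=\{1,2,3,\dots\}$ and $\mathbb{Z}_+=\mathbb{N}\cup\{0\}$. $\mathbb{C}_p$ is the completion of an algebraic closure of $\mathbb{Q}_p$. $T_p=\bigcup_{n\ge 1}\{\omega\in\mathbb{C}_p : \omega^{p^n}=1\}$ is the group of $p$-power roots of unity. For $\xi\in T_p$, a Dirichlet character $\chi$ with conductor $d$, and an integer $k\ge 0$, the generalized twisted Bernoulli polynomials of order $k$ attached to $\chi$, $B_{n,\chi,\xi}^{(k)}(x)$, are defined by the identity of formal power series in $t$ $$\left(\frac{t\sum_{a=0}^{d-1}\chi(a)\xi^a e^{at}}{\xi^d e^{dt}-1}\right)^k e^{xt}=\sum_{n=0}^{\infty}B_{n,\chi,\xi}^{(k)}(x)\frac{t^n}{n!}$$ (so for $k=0$ one has $B_{n,\chi,\xi}^{(0)}(x)=x^n$, with $0^0=1$). For $k,n\in\mathbb{Z}_+$, the power sums are $T_{k,\chi,\xi}(n)=\sum_{l=0}^{n}\chi(l)\xi^l l^k$, with $0^0=1$. -}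

module Defs where

open import Algebra.Apartness.Bundles using (HeytingField; HeytingCommutativeRing)
import Algebra.Apartness.Properties.HeytingCommutativeRing as HeytingProperties
open import Algebra.Bundles using (CommutativeRing)
open import Algebra.Morphism.Structures using (module RingMorphisms)
import Algebra.Properties.Ring as RingProperties
import Algebra.Properties.Semiring.Exp as SemiringExp
import Algebra.Properties.Semiring.Mult as SemiringMult
import Algebra.Properties.Semiring.Sum as SemiringSum
import Algebra.Solver.Ring.NaturalCoefficients.Default as NatSolver
open import Data.Fin.Base using (Fin; toℕ; inject₁; fromℕ)
import Data.Fin.Properties as Fin
open import Data.Integer.Base as ℤ using (ℤ; +_; -[1+_])
import Data.Integer.Coprimality as ℤ
import Data.Integer.Divisibility as ℤ
open import Data.Nat.Base as ℕ using (ℕ; zero; suc; NonZero; _∸_; _!)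
import Data.Nat.Coprimality as ℕ
import Data.Nat.Divisibility as ℕ
import Data.Nat.Properties as ℕ
open import Data.Nat.Primality using (Prime; prime⇒nonZero)
open import Data.Product.Base using (∃; _×_; _,_; proj₁; proj₂)
open import Data.Rational.Base as ℚ using (ℚ; 0ℚ; 1ℚ)
import Data.Rational.Properties as ℚ
open import Data.Sum.Base using (_⊎_; inj₁; inj₂)
open import Data.Vec.Functional using (Vector)
open import Level using (_⊔_; 0ℓ) renaming (suc to lsuc)
import Relation.Binary.Reasoning.Setoid as SetoidReasoning
open import Relation.Binary.PropositionalEquality as ≡ using (_≡_; _≢_)
open import Relation.Nullary.Negation using (¬_)

module Field {c ℓ₁ ℓ₂} (K : HeytingField c ℓ₁ ℓ₂) where

  open HeytingField K public using (_#_; heytingCommutativeRing; tight)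
  open HeytingCommutativeRing heytingCommutativeRing public
    using (commutativeRing; #⇒invertible; invertible⇒#; #-cotrans; #-sym)
  open CommutativeRing commutativeRing public
    hiding (zero) renaming (zeroˡ to *-zeroˡ; zeroʳ to *-zeroʳ)
  open HeytingProperties heytingCommutativeRing public
    using (1#0; x-0≈x; x#0y#0→xy#0; #-congʳ; #-congˡ)
  open SemiringSum semiring public
    using (sum; sum-syntax; sum⁺-syntax; sum-cong-≋; sum-init-last)

  open RingProperties ring public using (+-cancelʳ; -‿distribˡ-*)
  open SemiringExp semiring public using (_^_; ^-congˡ; ^-assocʳ; ^-congʳ)

  -- The image of a natural number in K.
  ⟨_⟩ : ℕ → Carrier
  ⟨ n ⟩ = n SM.× 1#
    where module SM = SemiringMult semiring

  inv : ∀ {x} → x # 0# → Carrier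
  inv x#0 = proj₁ (#⇒invertible x#0)

  inv-*ˡ : ∀ {x} (p : x # 0#) → inv p * x ≈ 1#
  inv-*ˡ {x} p = trans (*-congˡ (sym (x-0≈x x))) (proj₁ (proj₂ (#⇒invertible p)))

  inv-*ʳ : ∀ {x} (p : x # 0#) → x * inv p ≈ 1#
  inv-*ʳ p = trans (*-comm _ _) (inv-*ˡ p)

  -- a₀ + a₁ x + ⋯ + aₙ₋₁ xⁿ⁻¹ + xⁿ
  monic : ∀ {n} → Vector Carrier n → Carrier → Carrier
  monic {n} a x = x ^ n + ∑[ i < n ] (a i * x ^ toℕ i)

  AlgebraicallyClosed : Set (c ⊔ ℓ₁)
  AlgebraicallyClosed = ∀ n (a : Vector Carrier (suc n)) → ∃ λ x → monic a x ≈ 0#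

-- A rank one valuation, written additively and with v(0) = ∞ left implicit.
-- The values are rational: the value group of ℂₚ is ℚ when v(p) = 1.
record Valuation {c ℓ₁ ℓ₂} (K : HeytingField c ℓ₁ ℓ₂) : Set (c ⊔ ℓ₁ ⊔ ℓ₂) where
  open Field K
  field
    v      : ∀ x → x # 0# → ℚ
    v-cong : ∀ {x y} (p : x # 0#) (q : y # 0#) → x ≈ y → v x p ≡ v y q
    v-*    : ∀ {x y} (p : x # 0#) (q : y # 0#) (r : x * y # 0#) →
             v (x * y) r ≡ v x p ℚ.+ v y q
    v-+    : ∀ {x y} (p : x # 0#) (q : y # 0#) (r : x + y # 0#) →
             v x p ℚ.⊓ v y q ℚ.≤ v (x + y) r

  -- v(x) ≥ N, where v(0) = ∞
  Small : ℕ → Carrier → Set ℓ₂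
  Small N x = ∀ (p : x # 0#) → (+ N ℚ./ 1) ℚ.≤ v x p

  Cauchy : (ℕ → Carrier) → Set ℓ₂
  Cauchy s = ∀ N → ∃ λ M → ∀ i j → M ℕ.≤ i → M ℕ.≤ j → Small N (s i - s j)

  _⟶_ : (ℕ → Carrier) → Carrier → Set ℓ₂
  s ⟶ x = ∀ N → ∃ λ M → ∀ i → M ℕ.≤ i → Small N (s i - x)

  Complete : Set (c ⊔ ℓ₂)
  Complete = ∀ s → Cauchy s → ∃ (s ⟶_)

record ValuedField c ℓ₁ ℓ₂ : Set (lsuc (c ⊔ ℓ₁ ⊔ ℓ₂)) where
  field
    heytingField : HeytingField c ℓ₁ ℓ₂
    valuation    : Valuation heytingField
  open Field heytingField public
  open Valuation valuation public

module _ {c ℓ₁ ℓ₂ c′ ℓ₁′ ℓ₂′} (K : HeytingField c ℓ₁ ℓ₂) (L : HeytingField c′ ℓ₁′ ℓ₂′) where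
  private
    module K = Field K
    module L = Field L
  open RingMorphisms K.rawRing L.rawRing

  module FieldHom {f : K.Carrier → L.Carrier} (hom : IsRingHomomorphism f) where
    open IsRingHomomorphism hom

    hom-#0 : ∀ {x} → x K.# K.0# → f x L.# L.0#
    hom-#0 {x} p = L.invertible⇒# (f (K.inv p) , eqˡ , L.trans (L.*-comm _ _) eqˡ)
      where
      eqˡ : f (K.inv p) L.* (f x L.- L.0#) L.≈ L.1#
      eqˡ = L.trans (L.*-congˡ (L.x-0≈x _)) (L.trans (L.sym (*-homo _ _))
              (L.trans (⟦⟧-cong (K.inv-*ˡ p)) 1#-homo))

    hom-⟨⟩ : ∀ n → f K.⟨ n ⟩ L.≈ L.⟨ n ⟩
    hom-⟨⟩ zero    = 0#-homo
    hom-⟨⟩ (suc n) = L.trans (+-homo _ _) (L.+-cong 1#-homo (hom-⟨⟩ n))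

module _ {c ℓ₁ ℓ₂ c′ ℓ₁′ ℓ₂′} (K : ValuedField c ℓ₁ ℓ₂) (L : ValuedField c′ ℓ₁′ ℓ₂′) where
  private
    module K = ValuedField K
    module L = ValuedField L
  open RingMorphisms K.rawRing L.rawRing

  record IsValuedExtension (f : K.Carrier → L.Carrier) : Set (c ⊔ ℓ₁ ⊔ ℓ₂ ⊔ ℓ₁′ ⊔ ℓ₂′) where
    field
      isRingHomomorphism : IsRingHomomorphism f
      v-homo             : ∀ {x} (p : x K.# K.0#) (q : f x L.# L.0#) → L.v (f x) q ≡ K.v x p

  record IsCompletion (f : K.Carrier → L.Carrier) : Set (c ⊔ ℓ₁ ⊔ ℓ₂ ⊔ c′ ⊔ ℓ₁′ ⊔ ℓ₂′) where
    field
      isValuedExtension : IsValuedExtension f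
      complete          : L.Complete
      dense             : ∀ x N → ∃ λ a → L.Small N (x L.- f a)
    open IsValuedExtension isValuedExtension public

  record IsAlgebraicClosure (f : K.Carrier → L.Carrier) : Set (c ⊔ ℓ₁ ⊔ ℓ₂ ⊔ c′ ⊔ ℓ₁′ ⊔ ℓ₂′) where
    field
      isValuedExtension   : IsValuedExtension f
      algebraic           : ∀ x → ∃ λ n → ∃ λ (a : Vector K.Carrier n) →
                            L.monic (λ i → f (a i)) x L.≈ L.0#
      algebraicallyClosed : L.AlgebraicallyClosed
    open IsValuedExtension isValuedExtension public

module ℚField = Field ℚ.heytingField

-- By multiplicativity these two clauses determine v on all of ℚ∖{0}.
record IsPadicValuation (p : ℕ) (valuation : Valuation ℚ.heytingField) : Set where
  open Valuation valuation
  field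
    v-p : ∀ (q : ℚField.⟨ p ⟩ ≢ 0ℚ) → v ℚField.⟨ p ⟩ q ≡ 1ℚ
    v-n : ∀ n → ℕ.Coprime n p → ∀ (q : ℚField.⟨ n ⟩ ≢ 0ℚ) → v ℚField.⟨ n ⟩ q ≡ 0ℚ

-- ℂₚ is specified, uniquely up to isometric isomorphism, by the tower
-- ℚ ⊂ ℚₚ ⊂ (an algebraic closure of ℚₚ) ⊂ ℂₚ that constructs it.
record ℂ[_] (p : ℕ) c ℓ₁ ℓ₂ : Set (lsuc (c ⊔ ℓ₁ ⊔ ℓ₂)) where
  field
    ℚ-valuation : Valuation ℚ.heytingField
    isPadic     : IsPadicValuation p ℚ-valuation
  ℚ-valued : ValuedField 0ℓ 0ℓ 0ℓ
  ℚ-valued = record { heytingField = ℚ.heytingField ; valuation = ℚ-valuation }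

  field
    ℚₚ  : ValuedField c ℓ₁ ℓ₂
    ℚ̄ₚ  : ValuedField c ℓ₁ ℓ₂
    ℂₚ  : ValuedField c ℓ₁ ℓ₂
  private
    module Q  = ValuedField ℚₚ
    module Q̄  = ValuedField ℚ̄ₚ
    module C  = ValuedField ℂₚ
  field
    ι₁ : ℚ → Q.Carrier
    ι₂ : Q.Carrier → Q̄.Carrier
    ι₃ : Q̄.Carrier → C.Carrier
    isCompletion₁      : IsCompletion ℚ-valued ℚₚ ι₁
    isAlgebraicClosure : IsAlgebraicClosure ℚₚ ℚ̄ₚ ι₂
    isCompletion₂      : IsCompletion ℚ̄ₚ ℂₚ ι₃

  open ValuedField ℂₚ public using (heytingField)

  charZero : ∀ n .{{_ : NonZero n}} → C.⟨ n ⟩ C.# C.0#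
  charZero (suc n) = C.#-congʳ ι⟨⟩ (H₃.hom-#0 (H₂.hom-#0 (H₁.hom-#0 ≢0)))
    where
    h₁ = IsCompletion.isRingHomomorphism isCompletion₁
    h₂ = IsAlgebraicClosure.isRingHomomorphism isAlgebraicClosure
    h₃ = IsCompletion.isRingHomomorphism isCompletion₂
    module H₁ = FieldHom ℚ.heytingField Q.heytingField h₁
    module H₂ = FieldHom Q.heytingField Q̄.heytingField h₂
    module H₃ = FieldHom Q̄.heytingField C.heytingField h₃
    open RingMorphisms.IsRingHomomorphism using (⟦⟧-cong)
    nonNeg : ∀ k → 0ℚ ℚ.≤ ℚField.⟨ k ⟩
    nonNeg zero    = ℚ.≤-refl
    nonNeg (suc k) = ℚ.+-mono-≤ (ℚ.nonNegative⁻¹ 1ℚ) (nonNeg k)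
    ≢0 : ℚField.⟨ suc n ⟩ ≢ 0ℚ
    ≢0 eq = ℚ.<-irrefl (≡.sym eq) (ℚ.+-mono-<-≤ (ℚ.positive⁻¹ 1ℚ) (nonNeg n))
    ι⟨⟩ : ι₃ (ι₂ (ι₁ ℚField.⟨ suc n ⟩)) C.≈ C.⟨ suc n ⟩
    ι⟨⟩ = C.trans (⟦⟧-cong h₃ (Q̄.trans (⟦⟧-cong h₂ (H₁.hom-⟨⟩ (suc n))) (H₂.hom-⟨⟩ (suc n))))
                  (H₃.hom-⟨⟩ (suc n))

module PowerSeries {c ℓ₁ ℓ₂} (K : HeytingField c ℓ₁ ℓ₂)
  (charZero : ∀ n .{{_ : NonZero n}} →
    HeytingField._#_ K (Field.⟨_⟩ K n) (HeytingField.0# K)) where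

  open Field K

  infix  4 _≋_
  infixl 7 _⊗_

  -- Formal power series in t: f n is the coefficient of tⁿ (not of tⁿ/n!).
  Series : Set c
  Series = ℕ → Carrier

  _≋_ : Series → Series → Set ℓ₁
  f ≋ g = ∀ n → f n ≈ g n

  _⊗_ : Series → Series → Series
  (f ⊗ g) n = ∑[ i ≤ n ] (f (toℕ i) * g (n ∸ toℕ i))

  𝟙 : Series
  𝟙 zero    = 1#
  𝟙 (suc _) = 0#

  t·_ : Series → Series
  (t· f) zero    = 0#
  (t· f) (suc n) = f n

  pow : Series → ℕ → Series
  pow f zero    = 𝟙
  pow f (suc k) = f ⊗ pow f k

  ⟨_⟩⁻¹ : ∀ n .{{_ : NonZero n}} → Carrier
  ⟨ n ⟩⁻¹ = inv (charZero n)

  ⟨_!⟩⁻¹ : ℕ → Carrier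
  ⟨ n !⟩⁻¹ = ⟨ n ! ⟩⁻¹ {{n ℕ.!≢0}}

  -- e^{at}; here a ^ 0 = 1# also for a = 0.
  exp : Carrier → Series
  exp a n = a ^ n * ⟨ n !⟩⁻¹

  record Quotient (f g : Series) : Set (c ⊔ ℓ₁) where
    field
      quotient   : Series
      quotient-⊗ : quotient ⊗ g ≋ f
      unique     : ∀ q → q ⊗ g ≋ f → q ≋ quotient

  open SetoidReasoning setoid

  tail : Series → Series
  tail f n = f (suc n)

  module Divide (g : Series) (g₀#0 : g 0 # 0#) where
    private
      u = inv g₀#0

    remainder : Series → Series
    remainder f n = f (suc n) - f 0 * u * g (suc n)

    divide : Series → Series
    divide f zero    = f 0 * u
    divide f (suc n) = divide (remainder f) n

    divide-⊗ : ∀ f → divide f ⊗ g ≋ f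
    divide-⊗ f zero = begin
      f 0 * u * g 0 + 0#  ≈⟨ +-identityʳ _ ⟩
      f 0 * u * g 0       ≈⟨ *-assoc _ _ _ ⟩
      f 0 * (u * g 0)     ≈⟨ *-congˡ (inv-*ˡ g₀#0) ⟩
      f 0 * 1#            ≈⟨ *-identityʳ _ ⟩
      f 0                 ∎
    divide-⊗ f (suc n) = begin
      a + (divide (remainder f) ⊗ g) n  ≈⟨ +-congˡ (divide-⊗ (remainder f) n) ⟩
      a + (f (suc n) - a)               ≈⟨ +-comm _ _ ⟩
      f (suc n) - a + a                 ≈⟨ +-assoc _ _ _ ⟩
      f (suc n) + (- a + a)             ≈⟨ +-congˡ (-‿inverseˡ a) ⟩
      f (suc n) + 0#                    ≈⟨ +-identityʳ _ ⟩
      f (suc n)                         ∎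
      where a = f 0 * u * g (suc n)

    divide-unique : ∀ f q → q ⊗ g ≋ f → q ≋ divide f
    divide-unique f q eq zero = begin
      q 0             ≈⟨ *-identityʳ _ ⟨
      q 0 * 1#        ≈⟨ *-congˡ (inv-*ʳ g₀#0) ⟨
      q 0 * (g 0 * u) ≈⟨ *-assoc _ _ _ ⟨
      q 0 * g 0 * u   ≈⟨ *-congʳ (trans (sym (+-identityʳ _)) (eq 0)) ⟩
      f 0 * u         ∎
    divide-unique f q eq (suc n) = divide-unique (remainder f) (tail q) eq′ n
      where
      eq′ : tail q ⊗ g ≋ remainder f
      eq′ k = begin
        b              ≈⟨ +-identityʳ _ ⟨
        b + 0#         ≈⟨ +-congˡ (-‿inverseʳ a) ⟨
        b + (a - a)    ≈⟨ +-assoc _ _ _ ⟨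
        b + a - a      ≈⟨ +-cong (trans (+-comm _ _) (eq (suc k)))
                                 (-‿cong (*-congʳ (divide-unique f q eq zero))) ⟩
        remainder f k  ∎
        where
        a = q 0 * g (suc k)
        b = (tail q ⊗ g) k

    quotientByUnit : ∀ f → Quotient f g
    quotientByUnit f = record
      { quotient = divide f ; quotient-⊗ = divide-⊗ f ; unique = divide-unique f }

  ⊗-tail : ∀ {g} → g 0 ≈ 0# → ∀ q n → (q ⊗ g) (suc n) ≈ (q ⊗ tail g) n
  ⊗-tail {g} g₀≈0 q n = begin
    (q ⊗ g) (suc n)
      ≈⟨ sum-init-last {suc n} (λ i → q (toℕ i) * g (suc n ∸ toℕ i)) ⟩
    ∑[ i ≤ n ] (q (toℕ (inject₁ i)) * g (suc n ∸ toℕ (inject₁ i)))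
      + q (toℕ (fromℕ (suc n))) * g (suc n ∸ toℕ (fromℕ (suc n)))
      ≈⟨ +-cong (sum-cong-≋ eq) last≈0 ⟩
    (q ⊗ tail g) n + 0#
      ≈⟨ +-identityʳ _ ⟩
    (q ⊗ tail g) n ∎
    where
    eq : ∀ (i : Fin (suc n)) → q (toℕ (inject₁ i)) * g (suc n ∸ toℕ (inject₁ i))
                             ≈ q (toℕ i) * g (suc (n ∸ toℕ i))
    eq i = reflexive (≡.cong₂ (λ a b → q a * g b) (Fin.toℕ-inject₁ i)
      (≡.trans (≡.cong (suc n ∸_) (Fin.toℕ-inject₁ i)) (ℕ.+-∸-assoc 1 (Fin.toℕ≤pred[n] i))))
    last≈0 : q (toℕ (fromℕ (suc n))) * g (suc n ∸ toℕ (fromℕ (suc n))) ≈ 0#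
    last≈0 = begin
      q (toℕ (fromℕ (suc n))) * g (suc n ∸ toℕ (fromℕ (suc n)))
        ≈⟨ *-congˡ (reflexive (≡.cong g (≡.trans (≡.cong (suc n ∸_) (Fin.toℕ-fromℕ (suc n)))
                                                (ℕ.n∸n≡0 (suc n))))) ⟩
      q (toℕ (fromℕ (suc n))) * g 0  ≈⟨ *-congˡ g₀≈0 ⟩
      q (toℕ (fromℕ (suc n))) * 0#   ≈⟨ *-zeroʳ _ ⟩
      0#                             ∎

  quotientByOrder1 : ∀ {f g} → f 0 ≈ 0# → g 0 ≈ 0# → g 1 # 0# → Quotient f g
  quotientByOrder1 {f} {g} f₀≈0 g₀≈0 g₁#0 = record
    { quotient   = divide (tail f)
    ; quotient-⊗ = λ where
        zero    → trans (+-identityʳ _) (trans (*-congˡ g₀≈0) (trans (*-zeroʳ _) (sym f₀≈0)))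
        (suc n) → trans (⊗-tail {g} g₀≈0 (divide (tail f)) n) (divide-⊗ (tail f) n)
    ; unique     = λ q eq → divide-unique (tail f) q
        (λ n → trans (sym (⊗-tail {g} g₀≈0 q n)) (eq (suc n)))
    }
    where open Divide (tail g) g₁#0

  inv#0 : ∀ {x} (p : x # 0#) → inv p # 0#
  inv#0 {x} p = invertible⇒#
    (x , trans (*-congˡ (x-0≈x _)) (inv-*ʳ p) , trans (*-congʳ (x-0≈x _)) (inv-*ˡ p))

  exp₀ : ∀ a → exp a 0 ≈ 1#
  exp₀ a = begin
    1# * ⟨ 0 !⟩⁻¹           ≈⟨ *-congʳ (+-identityʳ 1#) ⟨
    ⟨ 1 ⟩ * ⟨ 0 !⟩⁻¹        ≈⟨ inv-*ʳ _ ⟩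
    1#                      ∎

  exp₁#0 : ∀ {a} → a # 0# → exp a 1 # 0#
  exp₁#0 a#0 = x#0y#0→xy#0 (x#0y#0→xy#0 a#0 1#0) (inv#0 _)

-- In characteristic 0 it is decidable whether a root of unity is 1.
module RootOfUnity {c ℓ₁ ℓ₂} (K : HeytingField c ℓ₁ ℓ₂) where

  open Field K
  open SetoidReasoning setoid
  open NatSolver commutativeSemiring using (solve; _:=_; _:+_; _:*_; con)

  private
    G R : Carrier → ℕ → Carrier
    G ζ zero    = 0#
    G ζ (suc n) = 1# + ζ * G ζ n
    R ζ zero    = 0#
    R ζ (suc n) = R ζ n + G ζ n

    G-eq : ∀ ζ n → ζ * G ζ n + 1# ≈ G ζ n + ζ ^ n
    G-eq ζ zero    = +-congʳ (*-zeroʳ ζ)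
    G-eq ζ (suc n) = begin
      ζ * (1# + ζ * G ζ n) + 1#
        ≈⟨ solve 2 (λ z g → z :* (con 1 :+ z :* g) :+ con 1 := con 1 :+ z :* (z :* g :+ con 1)) refl ζ (G ζ n) ⟩
      1# + ζ * (ζ * G ζ n + 1#)      ≈⟨ +-congˡ (*-congˡ (G-eq ζ n)) ⟩
      1# + ζ * (G ζ n + ζ ^ n)       ≈⟨ +-congˡ (distribˡ _ _ _) ⟩
      1# + (ζ * G ζ n + ζ * ζ ^ n)   ≈⟨ +-assoc _ _ _ ⟨
      1# + ζ * G ζ n + ζ * ζ ^ n     ∎

    R-eq : ∀ ζ n → ⟨ n ⟩ + ζ * R ζ n ≈ G ζ n + R ζ n
    R-eq ζ zero    = +-congˡ (*-zeroʳ ζ)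
    R-eq ζ (suc n) = begin
      1# + ⟨ n ⟩ + ζ * (R ζ n + G ζ n)
        ≈⟨ solve 4 (λ z m r g → con 1 :+ m :+ z :* (r :+ g) := con 1 :+ z :* g :+ (m :+ z :* r)) refl ζ ⟨ n ⟩ (R ζ n) (G ζ n) ⟩
      1# + ζ * G ζ n + (⟨ n ⟩ + ζ * R ζ n)  ≈⟨ +-congˡ (trans (R-eq ζ n) (+-comm _ _)) ⟩
      1# + ζ * G ζ n + (R ζ n + G ζ n)      ∎

    move : ∀ {a b c d} → a + b ≈ c + d → a - c ≈ d - b
    move {a} {b} {c} {d} eq = begin
      a - c                    ≈⟨ +-identityʳ _ ⟨
      a - c + 0#               ≈⟨ +-congˡ (-‿inverseʳ b) ⟨
      a - c + (b - b)
        ≈⟨ solve 4 (λ a c′ b b′ → a :+ c′ :+ (b :+ b′) := a :+ b :+ c′ :+ b′) refl a (- c) b (- b) ⟩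
      a + b - c - b            ≈⟨ +-congʳ (+-congʳ eq) ⟩
      c + d - c - b
        ≈⟨ solve 4 (λ c d c′ b′ → c :+ d :+ c′ :+ b′ := c :+ c′ :+ (d :+ b′)) refl c d (- c) (- b) ⟩
      c - c + (d - b)          ≈⟨ +-congʳ (-‿inverseʳ c) ⟩
      0# + (d - b)             ≈⟨ +-identityˡ _ ⟩
      d - b                    ∎

  ≈1⊎#1 : ∀ n → ⟨ n ⟩ # 0# → ∀ {ζ} → ζ ^ n ≈ 1# → ζ ≈ 1# ⊎ ζ # 1#
  ≈1⊎#1 n n#0 {ζ} ζⁿ≈1 with #-cotrans n#0 (G ζ n)
  ... | inj₂ G#0 = inj₁ (begin
    ζ                          ≈⟨ *-identityʳ _ ⟨
    ζ * 1#                     ≈⟨ *-congˡ (inv-*ʳ G#0) ⟨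
    ζ * (G ζ n * inv G#0)      ≈⟨ *-assoc _ _ _ ⟨
    ζ * G ζ n * inv G#0        ≈⟨ *-congʳ ζG≈G ⟩
    G ζ n * inv G#0            ≈⟨ inv-*ʳ G#0 ⟩
    1#                         ∎)
    where
    ζG≈G : ζ * G ζ n ≈ G ζ n
    ζG≈G = +-cancelʳ 1# _ _ (trans (G-eq ζ n) (+-congˡ ζⁿ≈1))
  ... | inj₁ n#G = inj₂ (#-sym (invertible⇒# (R ζ n * w , trans (*-comm _ _) eq , eq)))
    where
    w = proj₁ (#⇒invertible n#G)
    eq : (1# - ζ) * (R ζ n * w) ≈ 1#
    eq = begin
      (1# - ζ) * (R ζ n * w)      ≈⟨ *-assoc _ _ _ ⟨
      (1# - ζ) * R ζ n * w        ≈⟨ *-congʳ (distribʳ _ _ _) ⟩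
      (1# * R ζ n + - ζ * R ζ n) * w
        ≈⟨ *-congʳ (+-cong (*-identityˡ _) (sym (-‿distribˡ-* _ _))) ⟩
      (R ζ n - ζ * R ζ n) * w     ≈⟨ *-congʳ (move (R-eq ζ n)) ⟨
      (⟨ n ⟩ - G ζ n) * w         ≈⟨ proj₂ (proj₂ (#⇒invertible n#G)) ⟩
      1#                          ∎

module Dirichlet {c ℓ₁ ℓ₂} (K : HeytingField c ℓ₁ ℓ₂) where

  open Field K

  record IsDirichletCharacter (f : ℕ) (χ : ℤ → Carrier) : Set ℓ₁ where
    field
      χ-1      : χ (+ 1) ≈ 1#
      χ-*      : ∀ a b → χ (a ℤ.* b) ≈ χ a * χ b
      periodic : ∀ a b → + f ℤ.∣ a ℤ.- b → χ a ≈ χ b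
      vanish   : ∀ a → ¬ ℤ.Coprime a (+ f) → χ a ≈ 0#

  -- χ, as a character of (ℤ/f)ˣ, factors through (ℤ/e)ˣ.
  FactorsThrough : (f : ℕ) (χ : ℤ → Carrier) (e : ℕ) → Set ℓ₁
  FactorsThrough f χ e = ∀ a b → ℤ.Coprime a (+ f) → ℤ.Coprime b (+ f) →
                         + e ℤ.∣ a ℤ.- b → χ a ≈ χ b

  -- A character of conductor d is taken modulo d, i.e. it is primitive.
  record DirichletCharacter (d : ℕ) : Set (c ⊔ ℓ₁) where
    field
      value                : ℤ → Carrier
      isDirichletCharacter : IsDirichletCharacter d value
      conductor            : ∀ e → e ℕ.∣ d → FactorsThrough d value e → e ≡ d

module Twisted {c ℓ₁ ℓ₂} (K : HeytingField c ℓ₁ ℓ₂)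
  (charZero : ∀ n .{{_ : NonZero n}} →
    HeytingField._#_ K (Field.⟨_⟩ K n) (HeytingField.0# K))
  (p : ℕ) (p-prime : Prime p) where

  open Field K public
  open PowerSeries K charZero public
  open Dirichlet K public
  open DirichletCharacter

  -- Integer powers of a positive natural number w in K.
  powℤ : (w : ℕ) .{{_ : NonZero w}} → ℤ → Carrier
  powℤ w (+ n)    = ⟨ w ⟩ ^ n
  powℤ w -[1+ n ] = ⟨ w ⟩⁻¹ ^ suc n

  record Tₚ : Set (c ⊔ ℓ₁) where
    field
      ω       : Carrier
      n       : ℕ
      1≤n     : 1 ℕ.≤ n
      ω^pⁿ≈1  : ω ^ (p ℕ.^ n) ≈ 1#
  open Tₚ

  ^-swap : ∀ {x} N k → x ^ N ≈ 1# → (x ^ k) ^ N ≈ 1#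
  ^-swap {x} N k eq = begin
    (x ^ k) ^ N    ≈⟨ ^-assocʳ x k N ⟩
    x ^ (k ℕ.* N)  ≈⟨ ^-congʳ x (ℕ.*-comm k N) ⟩
    x ^ (N ℕ.* k)  ≈⟨ ^-assocʳ x N k ⟨
    (x ^ N) ^ k    ≈⟨ ^-congˡ k eq ⟩
    1# ^ k         ≈⟨ 1^ k ⟩
    1#             ∎
    where
    open SetoidReasoning setoid
    1^ : ∀ k → 1# ^ k ≈ 1#
    1^ zero    = refl
    1^ (suc k) = trans (*-identityˡ _) (1^ k)

  _^ᵀ_ : Tₚ → ℕ → Tₚ
  ξ ^ᵀ w = record
    { ω = ω ξ ^ w ; n = n ξ ; 1≤n = 1≤n ξ ; ω^pⁿ≈1 = ^-swap (p ℕ.^ n ξ) w (ω^pⁿ≈1 ξ) }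

  module _ {d : ℕ} .{{_ : NonZero d}} (χ : DirichletCharacter d) (ξ : Tₚ) where

    numerator : Series
    numerator = t· λ n → ∑[ a < d ] (χ .value (+ toℕ a) * ω ξ ^ toℕ a * exp ⟨ toℕ a ⟩ n)

    denominator : Series
    denominator n = ω ξ ^ d * exp ⟨ d ⟩ n - 𝟙 n

    private
      denominator₀ : denominator 0 ≈ ω ξ ^ d - 1#
      denominator₀ = +-congʳ (trans (*-congˡ (exp₀ ⟨ d ⟩)) (*-identityʳ _))

      ω#0 : ω ξ # 0#
      ω#0 with p ℕ.^ n ξ | ω^pⁿ≈1 ξ | ℕ.m^n≢0 p (n ξ) {{prime⇒nonZero p-prime}}
      ... | suc k | eq | _ = invertible⇒# (ω ξ ^ k
        , trans (*-congˡ (x-0≈x _)) (trans (*-comm _ _) eq) , trans (*-congʳ (x-0≈x _)) eq)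

      ^#0 : ∀ {x} k → x # 0# → x ^ k # 0#
      ^#0 zero    _   = 1#0
      ^#0 (suc k) x#0 = x#0y#0→xy#0 x#0 (^#0 k x#0)

    -- t Σ χ(a) ξᵃ e^{at} / (ξᵈ e^{dt} - 1). The denominator is a unit if
    -- ξᵈ ≠ 1 and has order 1 if ξᵈ = 1.
    generating : Quotient numerator denominator
    generating with RootOfUnity.≈1⊎#1 K (p ℕ.^ n ξ)
                      (charZero _ {{ℕ.m^n≢0 p (n ξ) {{prime⇒nonZero p-prime}}}})
                      (^-swap (p ℕ.^ n ξ) d (ω^pⁿ≈1 ξ))
    ... | inj₂ ξᵈ#1 = Divide.quotientByUnit denominator d₀#0 numerator
      where
      d₀#0 : denominator 0 # 0#
      d₀#0 = invertible⇒# (proj₁ i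
        , trans (*-congˡ eq) (proj₁ (proj₂ i)) , trans (*-congʳ eq) (proj₂ (proj₂ i)))
        where
        i = #⇒invertible ξᵈ#1
        eq = trans (x-0≈x _) denominator₀
    ... | inj₁ ξᵈ≈1 = quotientByOrder1 refl
      (trans denominator₀ (trans (+-congʳ ξᵈ≈1) (-‿inverseʳ 1#)))
      (#-congʳ (sym (x-0≈x _)) (x#0y#0→xy#0 (^#0 d ω#0) (exp₁#0 (charZero d))))

    F : Series
    F = Quotient.quotient generating

    B : (k n : ℕ) → Carrier → Carrier
    B k n x = ⟨ n ! ⟩ * (pow F k ⊗ exp x) n

    B-generating : ∀ k x → pow F k ⊗ exp x ≋ λ n → B k n x * ⟨ n !⟩⁻¹
    B-generating k x n = sym (begin
      ⟨ n ! ⟩ * h * ⟨ n !⟩⁻¹    ≈⟨ *-congʳ (*-comm _ _) ⟩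
      h * ⟨ n ! ⟩ * ⟨ n !⟩⁻¹    ≈⟨ *-assoc _ _ _ ⟩
      h * (⟨ n ! ⟩ * ⟨ n !⟩⁻¹)  ≈⟨ *-congˡ (inv-*ʳ _) ⟩
      h * 1#                    ≈⟨ *-identityʳ _ ⟩
      h                         ∎)
      where
      open SetoidReasoning setoid
      h = (pow F k ⊗ exp x) n

    powerSum : (k n : ℕ) → Carrier
    powerSum k n = ∑[ l ≤ n ] (χ .value (+ toℕ l) * ω ξ ^ toℕ l * ⟨ toℕ l ⟩ ^ k)

module Submission where

-- Write F(w) for the series t Σ χ(a) ξ^{wa} e^{at} / (ξ^{wd} e^{dt} - 1), with
-- a < d, and P(w, N) for Σ χ(l) ξ^{wl} e^{lt}, with l < N. Since P(w, N) is the
-- exponential generating series of the power sums, binomial convolution turns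
-- the left side of the identity into n! times the coefficient of tⁿ in
--
--   w₁⁻¹ F(w₁)(w₁t)ᵐ e^{w₁w₂xt} · P(w₂, w₁d)(w₂t) F(w₂)(w₂t)ᵐ⁻¹ e^{w₁w₂yt}
--
-- (side-HasEGF), and the right side is the same with w₁ and w₂ exchanged. The
-- exponentials and the powers F(w₁)(w₁t)ᵐ⁻¹ F(w₂)(w₂t)ᵐ⁻¹ are symmetric, so it
-- remains to see that w₁⁻¹ F(w₁)(w₁t) P(w₂, w₁d)(w₂t) is (sideEGF-sym).
--
-- As χ has period d, summing a geometric series over periods gives
-- P(w, vd) (ξ^{wd} e^{dt} - 1) = P(w, d) (ξ^{wvd} e^{vdt} - 1)
-- (partialSum-periods). The denominator of F(w) is cancellable, because F(w) is
-- the unique quotient by it (⊗-cancelʳ), so that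
-- t P(w, vd) = F(w) (ξ^{wvd} e^{vdt} - 1) (t·partialSum).
-- Taking v = w₁, w = w₂ and substituting w₂t for t,
-- w₂ t F(w₁)(w₁t) P(w₂, w₁d)(w₂t)
--   = F(w₁)(w₁t) F(w₂)(w₂t) (ξ^{w₁w₂d} e^{w₁w₂dt} - 1),
-- which is symmetric in w₁ and w₂ (exchange); t cancels, and dividing by w₁w₂
-- gives the claim.

open import Defs
open import Algebra.Apartness.Bundles using (HeytingField)
open import Algebra.Bundles using (CommutativeRing)
import Algebra.Construct.Pointwise as Pointwise
import Algebra.Properties.CommutativeSemiring.Binomial as BinomialTheorem
import Algebra.Properties.CommutativeSemiring.Exp as CommutativeExp
import Algebra.Properties.Ring as RingProperties
import Algebra.Properties.Semiring.Exp as SemiringExp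
import Algebra.Properties.Semiring.Mult as SemiringMult
import Algebra.Properties.Semiring.Sum as SemiringSum
import Algebra.Solver.Ring.NaturalCoefficients.Default as NatSolver
open import Data.Fin.Base using (toℕ)
import Data.Fin.Properties as Fin
open import Data.Integer.Base as ℤ using (+_)
import Data.Integer.Properties as ℤ
import Data.Integer.Divisibility as ℤ
open import Data.Nat.Base as ℕ using (ℕ; zero; suc; NonZero; _∸_; _!)
open import Data.Nat.Combinatorics using (_C_; nCk≡n!/k![n-k]!; k![n∸k]!∣n!)
import Data.Nat.Divisibility as ℕ
import Data.Nat.DivMod as ℕ
open import Data.Nat.Primality using (Prime)
import Data.Nat.Properties as ℕ
open import Data.Product.Base using (_,_)
open import Relation.Binary.PropositionalEquality as ≡ using (_≡_)
import Relation.Binary.Reasoning.Setoid as SetoidReasoning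

-- Formal power series over a field of characteristic 0

module SeriesRing {c ℓ₁ ℓ₂} (K : HeytingField c ℓ₁ ℓ₂)
  (charZero : ∀ n .{{_ : NonZero n}} →
    HeytingField._#_ K (Field.⟨_⟩ K n) (HeytingField.0# K)) where

  open Field K
  open PowerSeries K charZero
  open SemiringSum semiring using (∑-distrib-+; *-distribˡ-sum)
  open CommutativeExp commutativeSemiring using (^-distrib-*)
  open SemiringExp semiring using (^-homo-*)
  private
    module M = SemiringMult semiring
    module Solver = NatSolver commutativeSemiring

  -- The level of _⊙_ lies between those of _⊗_ and _^_, so that
  -- a ^ n ⊙ f ⊗ g stands for ((a ^ n) ⊙ f) ⊗ g.
  infixl 6 _⊕_
  infixr 7.5 _⊙_
  infix  4 _HasEGF_

  -- Sum, negation and zero are coefficientwise.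
  _⊕_ : Series → Series → Series
  (f ⊕ g) n = f n + g n

  ⊖_ : Series → Series
  (⊖ f) n = - f n

  𝟘 : Series
  𝟘 n = 0#

  -- Multiplication of a series by a scalar.
  _⊙_ : Carrier → Series → Series
  (a ⊙ f) n = a * f n

  ⊗-cong : ∀ {f f′ g g′} → f ≋ f′ → g ≋ g′ → f ⊗ g ≋ f′ ⊗ g′
  ⊗-cong p q n = sum-cong-≋ {suc n} (λ i → *-cong (p (toℕ i)) (q (n ∸ toℕ i)))

  ⊗-congˡ : ∀ f {g g′} → g ≋ g′ → f ⊗ g ≋ f ⊗ g′
  ⊗-congˡ f = ⊗-cong {f} {f} (λ _ → refl)

  ⊗-congʳ : ∀ g {f f′} → f ≋ f′ → f ⊗ g ≋ f′ ⊗ g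
  ⊗-congʳ g p = ⊗-cong {g = g} {g} p (λ _ → refl)

  ⊙-⊗ : ∀ a f g → (a ⊙ f) ⊗ g ≋ a ⊙ (f ⊗ g)
  ⊙-⊗ a f g n = trans (sum-cong-≋ {suc n} (λ i → *-assoc a (f (toℕ i)) (g (n ∸ toℕ i))))
    (sym (*-distribˡ-sum {suc n} a (λ i → f (toℕ i) * g (n ∸ toℕ i))))

  ⊗-distribʳ : ∀ h f g → (f ⊕ g) ⊗ h ≋ f ⊗ h ⊕ g ⊗ h
  ⊗-distribʳ h f g n = trans (sum-cong-≋ {suc n} (λ i → distribʳ (h (n ∸ toℕ i)) (f (toℕ i)) (g (toℕ i))))
    (∑-distrib-+ {suc n} (λ i → f (toℕ i) * h (n ∸ toℕ i)) (λ i → g (toℕ i) * h (n ∸ toℕ i)))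

  ⊗-zeroˡ : ∀ f → 𝟘 ⊗ f ≋ 𝟘
  ⊗-zeroˡ f zero    = trans (+-identityʳ _) (*-zeroˡ _)
  ⊗-zeroˡ f (suc n) = trans (+-cong (*-zeroˡ _) (⊗-zeroˡ f n)) (+-identityʳ _)

  ⊗-identityˡ : ∀ f → 𝟙 ⊗ f ≋ f
  ⊗-identityˡ f zero    = trans (+-identityʳ _) (*-identityˡ _)
  ⊗-identityˡ f (suc n) = trans (+-cong (*-identityˡ _) (⊗-zeroˡ f n)) (+-identityʳ _)

  -- The recursion (f ⊗ g) (suc n) = f 0 * g (suc n) + (tail f ⊗ g) n holds by
  -- definition; this is its mirror image.
  ⊗-suc : ∀ f g n → (f ⊗ g) (suc n) ≈ f (suc n) * g 0 + (f ⊗ tail g) n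
  ⊗-suc f g zero = Solver.solve 2 (λ a b → a :+ (b :+ con 0) := b :+ (a :+ con 0)) refl _ _
    where open Solver
  ⊗-suc f g (suc n) = trans (+-congˡ (⊗-suc (tail f) g n))
    (Solver.solve 3 (λ a b r → a :+ (b :+ r) := b :+ (a :+ r)) refl _ _ _)
    where open Solver

  ⊗-comm : ∀ f g → f ⊗ g ≋ g ⊗ f
  ⊗-comm f g zero    = +-congʳ (*-comm _ _)
  ⊗-comm f g (suc n) = trans (+-cong (*-comm _ _) (⊗-comm (tail f) g n))
    (sym (⊗-suc g f n))

  ⊗-assoc : ∀ f g h → (f ⊗ g) ⊗ h ≋ f ⊗ (g ⊗ h)
  ⊗-assoc f g h zero = Solver.solve 3
    (λ a b r → (a :* b :+ con 0) :* r :+ con 0 := a :* (b :* r :+ con 0) :+ con 0) refl _ _ _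
    where open Solver
  ⊗-assoc f g h (suc n) = begin
    (f 0 * g 0 + 0#) * h (suc n) + ((f 0 ⊙ tail g ⊕ tail f ⊗ g) ⊗ h) n
      ≈⟨ +-congˡ (trans (⊗-distribʳ h (f 0 ⊙ tail g) (tail f ⊗ g) n)
           (+-cong (⊙-⊗ (f 0) (tail g) h n) (⊗-assoc (tail f) g h n))) ⟩
    (f 0 * g 0 + 0#) * h (suc n) + (f 0 * (tail g ⊗ h) n + (tail f ⊗ (g ⊗ h)) n)
      ≈⟨ Solver.solve 5 (λ a b r s t → (a :* b :+ con 0) :* r :+ (a :* s :+ t)
           := a :* (b :* r :+ s) :+ t) refl (f 0) (g 0) (h (suc n)) _ _ ⟩
    f 0 * (g 0 * h (suc n) + (tail g ⊗ h) n) + (tail f ⊗ (g ⊗ h)) n ∎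
    where
    open Solver
    open SetoidReasoning setoid

  -- The ring K[[t]].
  seriesRing : CommutativeRing _ _
  seriesRing = record
    { Carrier = Series ; _≈_ = _≋_ ; _+_ = _⊕_ ; _*_ = _⊗_ ; -_ = ⊖_ ; 0# = 𝟘 ; 1# = 𝟙
    ; isCommutativeRing = record
      { isRing = record
        { +-isAbelianGroup = Pointwise.isAbelianGroup ℕ +-isAbelianGroup
        ; *-cong = ⊗-cong
        ; *-assoc = ⊗-assoc
        ; *-identity = ⊗-identityˡ , λ f n → trans (⊗-comm f 𝟙 n) (⊗-identityˡ f n)
        ; distrib = (λ h f g n → trans (⊗-comm h (f ⊕ g) n) (trans (⊗-distribʳ h f g n)
                       (+-cong (⊗-comm f h n) (⊗-comm g h n))))
                  , ⊗-distribʳ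
        }
      ; *-comm = ⊗-comm
      }
    }

  module S = CommutativeRing seriesRing
  module SeriesSolver = NatSolver S.commutativeSemiring

  ⊙-cong : ∀ {a b f g} → a ≈ b → f ≋ g → a ⊙ f ≋ b ⊙ g
  ⊙-cong p q n = *-cong p (q n)

  ⊗-⊙ : ∀ a f g → f ⊗ (a ⊙ g) ≋ a ⊙ (f ⊗ g)
  ⊗-⊙ a f g n = trans (⊗-comm f (a ⊙ g) n)
    (trans (⊙-⊗ a g f n) (*-congˡ (⊗-comm g f n)))

  -- The rearrangement that brings together the two factors α and σ on which
  -- the symmetry depends.
  ⊗-permute : ∀ α β γ σ u v →
    (σ ⊗ γ ⊗ u) ⊗ (α ⊗ β ⊗ v) ≋ (α ⊗ σ) ⊗ (β ⊗ γ ⊗ (v ⊗ u))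
  ⊗-permute = solve 6 (λ α β γ σ u v →
    (σ :* γ :* u) :* (α :* β :* v) := (α :* σ) :* (β :* γ :* (v :* u))) S.refl
    where open SeriesSolver

  ⊗-t· : ∀ f g → f ⊗ (t· g) ≋ t· (f ⊗ g)
  ⊗-t· f g zero    = trans (+-identityʳ _) (*-zeroʳ _)
  ⊗-t· f g (suc n) = trans (⊗-suc f (t· g) n)
    (trans (+-congʳ (*-zeroʳ _)) (+-identityˡ _))

  t·-⊗ : ∀ f g → (t· f) ⊗ g ≋ t· (f ⊗ g)
  t·-⊗ f g zero    = trans (+-identityʳ _) (*-zeroˡ _)
  t·-⊗ f g (suc n) = trans (+-congʳ (*-zeroˡ _)) (+-identityˡ _)

  t·-cong : ∀ {f g} → f ≋ g → t· f ≋ t· g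
  t·-cong p zero    = refl
  t·-cong p (suc n) = p n

  -- A series by which some series has a unique quotient q is cancellable: if
  -- h ⊗ g ≋ k ⊗ g, then q + (h - k) is again a quotient, so it equals q.
  ⊗-cancelʳ : ∀ {f g} → Quotient f g → ∀ h k → h ⊗ g ≋ k ⊗ g → h ≋ k
  ⊗-cancelʳ {f} {g} Q h k eq n = begin
    h n                  ≈⟨ +-identityʳ _ ⟨
    h n + 0#             ≈⟨ +-congˡ (-‿inverseˡ (k n)) ⟨
    h n + (- k n + k n)  ≈⟨ +-assoc _ _ _ ⟨
    h n - k n + k n      ≈⟨ +-congʳ difference≈0 ⟩
    0# + k n             ≈⟨ +-identityˡ _ ⟩
    k n                  ∎
    where
    open Quotient Q
    open RingProperties S.ring using () renaming (-‿distribˡ-* to ⊖-distribˡ-⊗)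
    open RingProperties ring using (+-cancelˡ)
    open SetoidReasoning setoid
    q′ : Series
    q′ = quotient ⊕ (h ⊕ ⊖ k)
    q′⊗g : q′ ⊗ g ≋ f
    q′⊗g = S.trans (⊗-distribʳ g quotient (h ⊕ ⊖ k)) (λ j → begin
      (quotient ⊗ g) j + ((h ⊕ ⊖ k) ⊗ g) j
        ≈⟨ +-cong (quotient-⊗ j) (⊗-distribʳ g h (⊖ k) j) ⟩
      f j + ((h ⊗ g) j + (⊖ k ⊗ g) j)
        ≈⟨ +-congˡ (+-cong (eq j) (sym (⊖-distribˡ-⊗ k g j))) ⟩
      f j + ((k ⊗ g) j - (k ⊗ g) j)  ≈⟨ +-congˡ (-‿inverseʳ _) ⟩
      f j + 0#                       ≈⟨ +-identityʳ _ ⟩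
      f j                            ∎)
    difference≈0 : h n - k n ≈ 0#
    difference≈0 = +-cancelˡ (quotient n) _ _
      (trans (unique q′ q′⊗g n) (sym (+-identityʳ _)))

  -- Substitution

  -- f(s t), the substitution of s t for t in f(t).
  scale : Carrier → Series → Series
  scale s f n = s ^ n * f n

  scale-cong : ∀ s {f g} → f ≋ g → scale s f ≋ scale s g
  scale-cong s p n = *-congˡ (p n)

  scale-⊗ : ∀ s f g → scale s (f ⊗ g) ≋ scale s f ⊗ scale s g
  scale-⊗ s f g n = trans (*-distribˡ-sum {suc n} (s ^ n) (λ i → f (toℕ i) * g (n ∸ toℕ i)))
    (sum-cong-≋ {suc n} λ i → begin
      s ^ n * (f (toℕ i) * g (n ∸ toℕ i))
        ≈⟨ *-congʳ (trans (^-congʳ s (≡.sym (ℕ.m+[n∸m]≡n (Fin.toℕ≤pred[n] i))))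
             (^-homo-* s (toℕ i) (n ∸ toℕ i))) ⟩
      s ^ toℕ i * s ^ (n ∸ toℕ i) * (f (toℕ i) * g (n ∸ toℕ i))
        ≈⟨ Solver.solve 4 (λ a b x y → a :* b :* (x :* y) := a :* x :* (b :* y)) refl
             (s ^ toℕ i) (s ^ (n ∸ toℕ i)) (f (toℕ i)) (g (n ∸ toℕ i)) ⟩
      s ^ toℕ i * f (toℕ i) * (s ^ (n ∸ toℕ i) * g (n ∸ toℕ i)) ∎)
    where
    open Solver
    open SetoidReasoning setoid

  scale-⊗₃ : ∀ s f g h {h′} → scale s h ≋ h′ →
    scale s (f ⊗ g ⊗ h) ≋ scale s f ⊗ scale s g ⊗ h′
  scale-⊗₃ s f g h p = S.trans (scale-⊗ s (f ⊗ g) h) (⊗-cong (scale-⊗ s f g) p)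

  scale-t· : ∀ s f → scale s (t· f) ≋ s ⊙ t· scale s f
  scale-t· s f zero    = trans (*-zeroʳ _) (sym (*-zeroʳ _))
  scale-t· s f (suc n) = *-assoc _ _ _

  scale-exp : ∀ s a → scale s (exp a) ≋ exp (s * a)
  scale-exp s a n = trans (sym (*-assoc _ _ _)) (*-congʳ (sym (^-distrib-* s a n)))

  -- Exponentials and exponential generating series

  exp-cong : ∀ {a b} → a ≈ b → exp a ≋ exp b
  exp-cong p n = *-congʳ (^-congˡ n p)

  ⟨⟩-* : ∀ m n → ⟨ m ℕ.* n ⟩ ≈ ⟨ m ⟩ * ⟨ n ⟩
  ⟨⟩-* = M.×1-homo-*

  ⟨⟩-+ : ∀ m n → ⟨ m ℕ.+ n ⟩ ≈ ⟨ m ⟩ + ⟨ n ⟩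
  ⟨⟩-+ = M.×-homo-+ 1#

  nCk*k!*[n∸k]!≡n! : ∀ {n k} → k ℕ.≤ n → (n C k) ℕ.* (k ! ℕ.* (n ∸ k) !) ≡ n !
  nCk*k!*[n∸k]!≡n! {n} {k} k≤n =
    ≡.trans (≡.cong (ℕ._* (k ! ℕ.* (n ∸ k) !)) (nCk≡n!/k![n-k]! k≤n))
      (ℕ.m/n*n≡m {{ℕ._!*_!≢0 k (n ∸ k)}} (k![n∸k]!∣n! k≤n))

  -- f is the exponential generating series of the sequence a.
  _HasEGF_ : (ℕ → Carrier) → Series → Set _
  a HasEGF f = ∀ n → a n ≈ ⟨ n ! ⟩ * f n

  -- Binomial convolution of sequences is multiplication of their exponential
  -- generating series.
  binomialConvolution : ∀ {a b f g} → a HasEGF f → b HasEGF g →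
    (λ n → ∑[ k ≤ n ] (⟨ n C toℕ k ⟩ * a (toℕ k) * b (n ∸ toℕ k))) HasEGF (f ⊗ g)
  binomialConvolution {a} {b} {f} {g} p q n = trans (sum-cong-≋ {suc n} λ i → begin
      ⟨ n C toℕ i ⟩ * a (toℕ i) * b (n ∸ toℕ i)
        ≈⟨ *-cong (*-congˡ (p (toℕ i))) (q (n ∸ toℕ i)) ⟩
      ⟨ n C toℕ i ⟩ * (⟨ toℕ i ! ⟩ * f (toℕ i)) * (⟨ (n ∸ toℕ i) ! ⟩ * g (n ∸ toℕ i))
        ≈⟨ Solver.solve 5 (λ c k l x y → c :* (k :* x) :* (l :* y) := c :* (k :* l) :* (x :* y))
             refl ⟨ n C toℕ i ⟩ ⟨ toℕ i ! ⟩ ⟨ (n ∸ toℕ i) ! ⟩ (f (toℕ i)) (g (n ∸ toℕ i)) ⟩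
      ⟨ n C toℕ i ⟩ * (⟨ toℕ i ! ⟩ * ⟨ (n ∸ toℕ i) ! ⟩) * (f (toℕ i) * g (n ∸ toℕ i))
        ≈⟨ *-congʳ (trans (⟨⟩-* (n C toℕ i) (toℕ i ! ℕ.* (n ∸ toℕ i) !))
             (*-congˡ (⟨⟩-* (toℕ i !) ((n ∸ toℕ i) !)))) ⟨
      ⟨ (n C toℕ i) ℕ.* (toℕ i ! ℕ.* (n ∸ toℕ i) !) ⟩ * (f (toℕ i) * g (n ∸ toℕ i))
        ≈⟨ *-congʳ (reflexive (≡.cong ⟨_⟩ (nCk*k!*[n∸k]!≡n! (Fin.toℕ≤pred[n] i)))) ⟩
      ⟨ n ! ⟩ * (f (toℕ i) * g (n ∸ toℕ i)) ∎)
    (sym (*-distribˡ-sum {suc n} ⟨ n ! ⟩ (λ i → f (toℕ i) * g (n ∸ toℕ i))))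
    where
    open Solver
    open SetoidReasoning setoid

  HasEGF-resp : ∀ {a b f} → (∀ n → a n ≈ b n) → b HasEGF f → a HasEGF f
  HasEGF-resp p q n = trans (p n) (q n)

  HasEGF-scale : ∀ {a f} s → a HasEGF f → (λ n → s ^ n * a n) HasEGF scale s f
  HasEGF-scale s p n = trans (*-congˡ (p n))
    (Solver.solve 3 (λ s k x → s :* (k :* x) := k :* (s :* x)) refl _ _ _)
    where open Solver

  HasEGF-⊙ : ∀ {a f} s → a HasEGF f → (λ n → s * a n) HasEGF (s ⊙ f)
  HasEGF-⊙ s p n = trans (*-congˡ (p n))
    (Solver.solve 3 (λ s k x → s :* (k :* x) := k :* (s :* x)) refl _ _ _)
    where open Solver

  n!*[n!]⁻¹ : ∀ n → ⟨ n ! ⟩ * ⟨ n !⟩⁻¹ ≈ 1#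
  n!*[n!]⁻¹ n = inv-*ʳ (charZero (n !) {{ℕ._!≢0 n}})

  -- A power series is determined by the sequence that it generates.
  EGF-unique : ∀ {a f g} → a HasEGF f → a HasEGF g → f ≋ g
  EGF-unique {a} {f} {g} p q n = trans (half f p) (sym (half g q))
    where
    open SetoidReasoning setoid
    half : ∀ h → a HasEGF h → h n ≈ ⟨ n !⟩⁻¹ * a n
    half h r = sym (begin
      ⟨ n !⟩⁻¹ * a n              ≈⟨ *-congˡ (r n) ⟩
      ⟨ n !⟩⁻¹ * (⟨ n ! ⟩ * h n)  ≈⟨ *-assoc _ _ _ ⟨
      ⟨ n !⟩⁻¹ * ⟨ n ! ⟩ * h n    ≈⟨ *-congʳ (trans (*-comm _ _) (n!*[n!]⁻¹ n)) ⟩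
      1# * h n                    ≈⟨ *-identityˡ _ ⟩
      h n                         ∎)

  powers-HasEGF-exp : ∀ a → (λ n → a ^ n) HasEGF exp a
  powers-HasEGF-exp a n = sym (begin
    ⟨ n ! ⟩ * (a ^ n * ⟨ n !⟩⁻¹)
      ≈⟨ Solver.solve 3 (λ k x i → k :* (x :* i) := k :* i :* x) refl _ _ _ ⟩
    ⟨ n ! ⟩ * ⟨ n !⟩⁻¹ * a ^ n    ≈⟨ *-congʳ (n!*[n!]⁻¹ n) ⟩
    1# * a ^ n                    ≈⟨ *-identityˡ _ ⟩
    a ^ n                         ∎)
    where
    open Solver
    open SetoidReasoning setoid

  exp-+ : ∀ a b → exp (a + b) ≋ exp a ⊗ exp b
  exp-+ a b = EGF-unique {λ n → (a + b) ^ n} (powers-HasEGF-exp (a + b))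
    (HasEGF-resp
      (λ n → trans (BinomialTheorem.theorem commutativeSemiring n a b)
        (sum-cong-≋ {suc n} λ i → 
          let z = a ^ toℕ i * b ^ (n ∸ toℕ i) in
          sym (trans (*-assoc ⟨ n C toℕ i ⟩ (a ^ toℕ i) (b ^ (n ∸ toℕ i)))
            (trans (M.×-assoc-* (n C toℕ i) 1# z) (M.×-congʳ (n C toℕ i) (*-identityˡ z))))))
      (binomialConvolution (powers-HasEGF-exp a) (powers-HasEGF-exp b)))

  exp-0 : exp 0# ≋ 𝟙
  exp-0 zero    = exp₀ 0#
  exp-0 (suc n) = trans (*-congʳ (*-zeroˡ _)) (*-zeroˡ _)

  -- Periodic character sums

  -- The sum of the first N terms of a sequence of series.
  partialSum : (ℕ → Series) → ℕ → Series
  partialSum f N n = ∑[ l < N ] f (toℕ l) n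

  partialSum-+ : ∀ f M N →
    partialSum f (M ℕ.+ N) ≋ partialSum f M ⊕ partialSum (λ l → f (M ℕ.+ l)) N
  partialSum-+ f zero    N n = sym (+-identityˡ _)
  partialSum-+ f (suc M) N n =
    trans (+-congˡ (partialSum-+ (λ l → f (suc l)) M N n)) (sym (+-assoc _ _ _))

  partialSum-cong : ∀ {f g} → (∀ l → f l ≋ g l) → ∀ N → partialSum f N ≋ partialSum g N
  partialSum-cong p N n = sum-cong-≋ {N} (λ l → p (toℕ l) n)

  ⊗-partialSum : ∀ u f N → u ⊗ partialSum f N ≋ partialSum (λ l → u ⊗ f l) N
  ⊗-partialSum u f zero    = S.zeroʳ u
  ⊗-partialSum u f (suc N) = S.trans (S.distribˡ u (f 0) (partialSum (λ l → f (suc l)) N))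
    (S.+-congˡ (⊗-partialSum u (λ l → f (suc l)) N))

  -- Sums Σ χ(l) ωˡ e^{lt} whose coefficients χ have period d.
  module PeriodicSum (d : ℕ) (χ : ℕ → Carrier) (periodic : ∀ l → χ (d ℕ.+ l) ≈ χ l)
    (ω : Carrier) where

    -- ωᴺ e^{Nt}
    u : ℕ → Series
    u N = ω ^ N ⊙ exp ⟨ N ⟩

    -- ωᴺ e^{Nt} - 1
    E : ℕ → Series
    E N = u N ⊕ ⊖ 𝟙

    -- χ(l) ωˡ e^{lt}, bracketed so that its coefficients are those in the
    -- numerator of the generating function of the Bernoulli polynomials.
    term : ℕ → Series
    term l n = χ l * ω ^ l * exp ⟨ l ⟩ n

    u-+ : ∀ M N → u (M ℕ.+ N) ≋ u M ⊗ u N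
    u-+ M N = begin
      ω ^ (M ℕ.+ N) ⊙ exp ⟨ M ℕ.+ N ⟩
        ≈⟨ ⊙-cong (^-homo-* ω M N) (S.trans (exp-cong (⟨⟩-+ M N)) (exp-+ ⟨ M ⟩ ⟨ N ⟩)) ⟩
      (ω ^ M * ω ^ N) ⊙ (exp ⟨ M ⟩ ⊗ exp ⟨ N ⟩)
        ≈⟨ (λ n → *-assoc _ _ _) ⟩
      ω ^ M ⊙ (ω ^ N ⊙ (exp ⟨ M ⟩ ⊗ exp ⟨ N ⟩))
        ≈⟨ ⊙-cong refl (⊗-⊙ (ω ^ N) (exp ⟨ M ⟩) (exp ⟨ N ⟩)) ⟨
      ω ^ M ⊙ (exp ⟨ M ⟩ ⊗ u N)
        ≈⟨ ⊙-⊗ (ω ^ M) (exp ⟨ M ⟩) (u N) ⟨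
      u M ⊗ u N ∎
      where open SetoidReasoning S.setoid

    u-0 : u 0 ≋ 𝟙
    u-0 n = trans (*-identityˡ _) (exp-0 n)

    term-shift : ∀ l → term (d ℕ.+ l) ≋ u d ⊗ term l
    term-shift l = begin
      term (d ℕ.+ l)       ≈⟨ (λ n → trans (*-assoc _ _ _) (*-congʳ (periodic l))) ⟩
      χ l ⊙ u (d ℕ.+ l)    ≈⟨ ⊙-cong refl (u-+ d l) ⟩
      χ l ⊙ (u d ⊗ u l)    ≈⟨ ⊗-⊙ (χ l) (u d) (u l) ⟨
      u d ⊗ (χ l ⊙ u l)    ≈⟨ ⊗-congˡ (u d) (λ n → *-assoc _ _ _) ⟨
      u d ⊗ term l         ∎
      where open SetoidReasoning S.setoid

    -- u (M + N) - 1 = (u M - 1) + u M (u N - 1)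
    E-+ : ∀ M N → E (M ℕ.+ N) ≋ E M ⊕ u M ⊗ E N
    E-+ M N n = begin
      u (M ℕ.+ N) n - 𝟙 n                        ≈⟨ +-congʳ (u-+ M N n) ⟩
      (u M ⊗ u N) n - 𝟙 n                        ≈⟨ +-comm _ _ ⟩
      - 𝟙 n + (u M ⊗ u N) n                      ≈⟨ +-congʳ (+-identityˡ _) ⟨
      0# - 𝟙 n + (u M ⊗ u N) n                   ≈⟨ +-congʳ (+-congʳ (-‿inverseʳ (u M n))) ⟨
      u M n - u M n - 𝟙 n + (u M ⊗ u N) n
        ≈⟨ Solver.solve 4 (λ a a′ i b → a :+ a′ :+ i :+ b := a :+ i :+ (b :+ a′)) refl _ _ _ _ ⟩
      u M n - 𝟙 n + ((u M ⊗ u N) n - u M n)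
        ≈⟨ +-congˡ (+-congˡ (trans (-‿cong (sym (S.*-identityʳ (u M) n)))
             (⊖-distribʳ-⊗ (u M) 𝟙 n))) ⟩
      u M n - 𝟙 n + ((u M ⊗ u N) n + (u M ⊗ ⊖ 𝟙) n)
        ≈⟨ +-congˡ (S.distribˡ (u M) (u N) (⊖ 𝟙) n) ⟨
      E M n + (u M ⊗ E N) n                      ∎
      where
      open Solver
      open SetoidReasoning setoid
      open RingProperties S.ring using () renaming (-‿distribʳ-* to ⊖-distribʳ-⊗)

    E-0 : E 0 ≋ 𝟘
    E-0 n = trans (+-congʳ (u-0 n)) (-‿inverseʳ _)

    -- The geometric sum over w periods, with the denominator cleared.
    partialSum-periods : ∀ w → partialSum term (w ℕ.* d) ⊗ E d ≋ partialSum term d ⊗ E (w ℕ.* d)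
    partialSum-periods zero    = S.trans (S.zeroˡ (E d)) (S.sym
      (S.trans (⊗-congˡ (partialSum term d) E-0) (S.zeroʳ (partialSum term d))))
    partialSum-periods (suc w) = begin
      partialSum term (d ℕ.+ w ℕ.* d) ⊗ E d
        ≈⟨ ⊗-congʳ (E d) (partialSum-+ term d (w ℕ.* d)) ⟩
      (P ⊕ partialSum (λ l → term (d ℕ.+ l)) (w ℕ.* d)) ⊗ E d
        ≈⟨ ⊗-congʳ (E d) (S.+-congˡ {x = P} (S.trans (partialSum-cong term-shift (w ℕ.* d))
             (S.sym (⊗-partialSum (u d) term (w ℕ.* d))))) ⟩
      (P ⊕ u d ⊗ Q) ⊗ E d
        ≈⟨ solve 4 (λ p u q e → (p :+ u :* q) :* e := p :* e :+ u :* (q :* e)) S.refl P (u d) Q (E d) ⟩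
      P ⊗ E d ⊕ u d ⊗ (Q ⊗ E d)
        ≈⟨ S.+-congˡ (⊗-congˡ (u d) (partialSum-periods w)) ⟩
      P ⊗ E d ⊕ u d ⊗ (P ⊗ E (w ℕ.* d))
        ≈⟨ solve 4 (λ p u e e′ → p :* e :+ u :* (p :* e′) := p :* (e :+ u :* e′))
             S.refl P (u d) (E d) (E (w ℕ.* d)) ⟩
      P ⊗ (E d ⊕ u d ⊗ E (w ℕ.* d))
        ≈⟨ ⊗-congˡ P (E-+ d (w ℕ.* d)) ⟨
      P ⊗ E (d ℕ.+ w ℕ.* d) ∎
      where
      open SetoidReasoning S.setoid
      open SeriesSolver
      P = partialSum term d
      Q = partialSum term (w ℕ.* d)

    -- For Q the quotient F that defines the Bernoulli polynomials, this is
    -- t P = F E: the sum P over w periods is F (ω^{wd} e^{wdt} - 1) / t.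
    t·partialSum : (Q : Quotient (t· partialSum term d) (E d)) → ∀ w →
      t· partialSum term (w ℕ.* d) ≋ Quotient.quotient Q ⊗ E (w ℕ.* d)
    t·partialSum Q w = ⊗-cancelʳ Q _ _ (begin
      t· partialSum term (w ℕ.* d) ⊗ E d      ≈⟨ t·-⊗ (partialSum term (w ℕ.* d)) (E d) ⟩
      t· (partialSum term (w ℕ.* d) ⊗ E d)    ≈⟨ t·-cong (partialSum-periods w) ⟩
      t· (partialSum term d ⊗ E (w ℕ.* d))    ≈⟨ t·-⊗ (partialSum term d) (E (w ℕ.* d)) ⟨
      (t· partialSum term d) ⊗ E (w ℕ.* d)    ≈⟨ ⊗-congʳ (E (w ℕ.* d)) (Quotient.quotient-⊗ Q) ⟨
      (F ⊗ E d) ⊗ E (w ℕ.* d)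
        ≈⟨ solve 3 (λ f a b → f :* a :* b := f :* b :* a) S.refl F (E d) (E (w ℕ.* d)) ⟩
      (F ⊗ E (w ℕ.* d)) ⊗ E d                 ∎)
      where
      open SetoidReasoning S.setoid
      open SeriesSolver
      F = Quotient.quotient Q

    scale-E : ∀ s N → scale s (E N) ≋ ω ^ N ⊙ exp (s * ⟨ N ⟩) ⊕ ⊖ 𝟙
    scale-E s N n = trans (distribˡ _ _ _) (+-cong
      (trans (Solver.solve 3 (λ a b x → a :* (b :* x) := b :* (a :* x)) refl _ _ _)
        (*-congˡ (scale-exp s ⟨ N ⟩ n)))
      (constant n))
      where
      open Solver
      open RingProperties ring using (-0#≈0#)
      constant : scale s (⊖ 𝟙) ≋ ⊖ 𝟙
      constant zero    = *-identityˡ _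
      constant (suc n) = trans (*-congˡ -0#≈0#) (trans (*-zeroʳ _) (sym -0#≈0#))

  scale-t·-⊗ : ∀ s {P F E} → t· P ≋ F ⊗ E → s ⊙ t· scale s P ≋ scale s F ⊗ scale s E
  scale-t·-⊗ s {P} {F} {E} p =
    S.trans (S.sym (scale-t· s P)) (S.trans (scale-cong s p) (scale-⊗ s F E))

  -- Multiplied by t, both sides are F₁(s₁t) F₂(s₂t) E, where E is the common
  -- value of E₁(s₁t) and E₂(s₂t). The two are compared in degree n + 1, where t
  -- cancels.
  exchange : ∀ s₁ s₂ {P₁ P₂ F₁ F₂ E₁ E₂} → t· P₁ ≋ F₁ ⊗ E₁ → t· P₂ ≋ F₂ ⊗ E₂ →
    scale s₁ E₁ ≋ scale s₂ E₂ →
    s₂ ⊙ (scale s₁ F₁ ⊗ scale s₂ P₂) ≋ s₁ ⊙ (scale s₂ F₂ ⊗ scale s₁ P₁)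
  exchange s₁ s₂ {P₁} {P₂} {F₁} {F₂} {E₁} {E₂} p₁ p₂ e n = begin
    s₂ * (A₁ ⊗ Q₂) n           ≈⟨ *-congˡ (⊗-t· A₁ Q₂ (suc n)) ⟨
    s₂ * (A₁ ⊗ t· Q₂) (suc n)  ≈⟨ ⊗-⊙ s₂ A₁ (t· Q₂) (suc n) ⟨
    (A₁ ⊗ s₂ ⊙ t· Q₂) (suc n)  ≈⟨ ⊗-congˡ A₁ (scale-t·-⊗ s₂ {P₂} {F₂} {E₂} p₂) (suc n) ⟩
    (A₁ ⊗ (A₂ ⊗ scale s₂ E₂)) (suc n)
      ≈⟨ ⊗-congˡ A₁ (⊗-congˡ A₂ e) (suc n) ⟨
    (A₁ ⊗ (A₂ ⊗ scale s₁ E₁)) (suc n)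
      ≈⟨ solve 3 (λ a b c → a :* (b :* c) := b :* (a :* c)) S.refl A₁ A₂ (scale s₁ E₁) (suc n) ⟩
    (A₂ ⊗ (A₁ ⊗ scale s₁ E₁)) (suc n)
      ≈⟨ ⊗-congˡ A₂ (scale-t·-⊗ s₁ {P₁} {F₁} {E₁} p₁) (suc n) ⟨
    (A₂ ⊗ s₁ ⊙ t· Q₁) (suc n)  ≈⟨ ⊗-⊙ s₁ A₂ (t· Q₁) (suc n) ⟩
    s₁ * (A₂ ⊗ t· Q₁) (suc n)  ≈⟨ *-congˡ (⊗-t· A₂ Q₁ (suc n)) ⟩
    s₁ * (A₂ ⊗ Q₁) n           ∎
    where
    open SetoidReasoning setoid
    open SeriesSolver
    A₁ = scale s₁ F₁
    A₂ = scale s₂ F₂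
    Q₁ = scale s₁ P₁
    Q₂ = scale s₂ P₂

-- The identity of generating series

module SymmetricIdentity {c ℓ₁ ℓ₂} (K : HeytingField c ℓ₁ ℓ₂)
  (charZero : ∀ n .{{_ : NonZero n}} →
    HeytingField._#_ K (Field.⟨_⟩ K n) (HeytingField.0# K))
  (p : ℕ) (p-prime : Prime p) where

  open Twisted K charZero p p-prime
  open SeriesRing K charZero
  open DirichletCharacter
  open Tₚ
  private
    module Solver = NatSolver commutativeSemiring

  powℤ-∸-1 : ∀ w .{{_ : NonZero w}} {n j} → j ℕ.≤ n →
    powℤ w (+ n ℤ.- + j ℤ.- + 1) ≈ ⟨ w ⟩ ^ (n ∸ j) * ⟨ w ⟩⁻¹
  powℤ-∸-1 w {n} {j} j≤n = trans
    (reflexive (≡.cong (λ i → powℤ w (i ℤ.- + 1)) (≡.trans (ℤ.m-n≡m⊖n n j) (ℤ.⊖-≥ j≤n))))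
    (pred (n ∸ j))
    where
    open SetoidReasoning setoid
    pred : ∀ k → powℤ w (+ k ℤ.- + 1) ≈ ⟨ w ⟩ ^ k * ⟨ w ⟩⁻¹
    pred zero    = *-comm _ _
    pred (suc k) = begin
      ⟨ w ⟩ ^ k                        ≈⟨ *-identityʳ _ ⟨
      ⟨ w ⟩ ^ k * 1#                   ≈⟨ *-congˡ (inv-*ʳ (charZero w)) ⟨
      ⟨ w ⟩ ^ k * (⟨ w ⟩ * ⟨ w ⟩⁻¹)    ≈⟨ *-assoc _ _ _ ⟨
      ⟨ w ⟩ ^ k * ⟨ w ⟩ * ⟨ w ⟩⁻¹      ≈⟨ *-congʳ (*-comm _ _) ⟩
      ⟨ w ⟩ ^ suc k * ⟨ w ⟩⁻¹          ∎

  module _ {d : ℕ} .{{_ : NonZero d}} (χ : DirichletCharacter d) where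

    -- χ restricted to the natural numbers.
    χℕ : ℕ → Carrier
    χℕ l = χ .value (+ l)

    χℕ-periodic : ∀ l → χℕ (d ℕ.+ l) ≈ χℕ l
    χℕ-periodic l = IsDirichletCharacter.periodic (isDirichletCharacter χ) _ _
      (≡.subst (+ d ℤ.∣_) (≡.sym d+l-l≡d) ℕ.∣-refl)
      where
      d+l-l≡d : + (d ℕ.+ l) ℤ.- + l ≡ + d
      d+l-l≡d = ≡.trans (ℤ.m-n≡m⊖n (d ℕ.+ l) l)
        (≡.trans (ℤ.⊖-≥ (ℕ.m≤n+m l d)) (≡.cong +_ (ℕ.m+n∸n≡m d l)))

    -- The series ξᴺ e^{Nt}, ξᴺ e^{Nt} - 1 and χ(l) ξˡ e^{lt} for a root of unity ξ.
    module Periodic (ξ : Tₚ) = PeriodicSum d χℕ χℕ-periodic (ω ξ)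

    -- Σ χ(l) ξˡ e^{lt} with l < N, the exponential generating series of the
    -- power sums up to N - 1.
    sums : Tₚ → ℕ → Series
    sums ξ = partialSum (Periodic.term ξ)

    powerSum-HasEGF : ∀ ξ N .{{_ : NonZero N}} →
      (λ k → powerSum χ ξ k (N ∸ 1)) HasEGF sums ξ N
    powerSum-HasEGF ξ (suc N) k = trans
      (sum-cong-≋ {suc N} (λ l → trans (*-congˡ (powers-HasEGF-exp ⟨ toℕ l ⟩ k))
        (Solver.solve 3 (λ a f e → a :* (f :* e) := f :* (a :* e)) refl
          (χℕ (toℕ l) * ω ξ ^ toℕ l) ⟨ k ! ⟩ (exp ⟨ toℕ l ⟩ k))))
      (sym (*-distribˡ-sum {suc N} ⟨ k ! ⟩ (λ l → Periodic.term ξ (toℕ l) k)))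
      where
      open Solver
      open SemiringSum semiring using (*-distribˡ-sum)

    t·sums : ∀ ξ w → t· sums ξ (w ℕ.* d) ≋ F χ ξ ⊗ Periodic.E ξ (w ℕ.* d)
    t·sums ξ = Periodic.t·partialSum ξ (generating χ ξ)

    module _ (ξ : Tₚ) where

      -- Both are ξ^{w₁w₂d} e^{w₁w₂dt} - 1.
      scale-E-sym : ∀ w₁ w₂ →
        scale ⟨ w₁ ⟩ (Periodic.E (ξ ^ᵀ w₁) (w₂ ℕ.* d)) ≋
        scale ⟨ w₂ ⟩ (Periodic.E (ξ ^ᵀ w₂) (w₁ ℕ.* d))
      scale-E-sym w₁ w₂ = S.trans (normal w₁ w₂) (S.trans
        (λ n → +-congʳ (*-cong (^-congʳ (ω ξ) exponents)
          (exp-cong (reflexive (≡.cong ⟨_⟩ exponents)) n)))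
        (S.sym (normal w₂ w₁)))
        where
        exponents : w₁ ℕ.* (w₂ ℕ.* d) ≡ w₂ ℕ.* (w₁ ℕ.* d)
        exponents = ≡.trans (≡.sym (ℕ.*-assoc w₁ w₂ d))
          (≡.trans (≡.cong (ℕ._* d) (ℕ.*-comm w₁ w₂)) (ℕ.*-assoc w₂ w₁ d))
        normal : ∀ w v → scale ⟨ w ⟩ (Periodic.E (ξ ^ᵀ w) (v ℕ.* d)) ≋
          Periodic.E ξ (w ℕ.* (v ℕ.* d))
        normal w v = S.trans (Periodic.scale-E (ξ ^ᵀ w) ⟨ w ⟩ (v ℕ.* d))
          (λ n → +-congʳ (*-cong (^-assocʳ (ω ξ) w (v ℕ.* d))
            (exp-cong (sym (⟨⟩-* w (v ℕ.* d))) n)))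

      -- One side of the identity as a function of n; the argument m is one less
      -- than the order of the first Bernoulli polynomial.
      side : (w₁ w₂ : ℕ) .{{_ : NonZero w₁}} (m : ℕ) (x y : Carrier) → ℕ → Carrier
      side w₁ w₂ m x y n = ∑[ j ≤ n ]
        (⟨ n C toℕ j ⟩ * ⟨ w₂ ⟩ ^ toℕ j * powℤ w₁ (+ n ℤ.- + toℕ j ℤ.- + 1)
          * B χ (ξ ^ᵀ w₁) (suc m) (n ∸ toℕ j) (⟨ w₂ ⟩ * x)
          * ∑[ k ≤ toℕ j ]
              (⟨ toℕ j C toℕ k ⟩ * powerSum χ (ξ ^ᵀ w₂) (toℕ k) (w₁ ℕ.* d ∸ 1)
                * B χ (ξ ^ᵀ w₂) m (toℕ j ∸ toℕ k) (⟨ w₁ ⟩ * y)))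

      -- F(w)(wt), where F(w) is the series F attached to ξʷ.
      scaledF : ℕ → Series
      scaledF w = scale ⟨ w ⟩ (F χ (ξ ^ᵀ w))

      -- F(w)(wt)ᵐ
      scaledPow : ℕ → ℕ → Series
      scaledPow m w = scale ⟨ w ⟩ (pow (F χ (ξ ^ᵀ w)) m)

      -- Σ χ(l) ξ^{w₂l} e^{w₂lt} with l < w₁d.
      scaledSums : ℕ → ℕ → Series
      scaledSums w₁ w₂ = scale ⟨ w₂ ⟩ (sums (ξ ^ᵀ w₂) (w₁ ℕ.* d))

      -- The exponential generating series of side w₁ w₂ m x y. The factors are
      -- grouped so that each group is symmetric under the exchange of w₁ and w₂.
      sideEGF : (w₁ w₂ : ℕ) .{{_ : NonZero w₁}} (m : ℕ) (x y : Carrier) → Series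
      sideEGF w₁ w₂ m x y =
        (⟨ w₁ ⟩⁻¹ ⊙ (scaledF w₁ ⊗ scaledSums w₁ w₂)) ⊗
          (scaledPow m w₁ ⊗ scaledPow m w₂ ⊗
            (exp (⟨ w₁ ⟩ * (⟨ w₂ ⟩ * x)) ⊗ exp (⟨ w₂ ⟩ * (⟨ w₁ ⟩ * y))))

      side-HasEGF : ∀ w₁ w₂ .{{_ : NonZero w₁}} m x y →
        side w₁ w₂ m x y HasEGF sideEGF w₁ w₂ m x y
      side-HasEGF w₁ w₂ m x y n = begin
        side w₁ w₂ m x y n
          ≈⟨ sum-cong-≋ {suc n} (λ j → trans
               (*-congʳ (*-congʳ (*-congˡ (powℤ-∸-1 w₁ (Fin.toℕ≤pred[n] j)))))
               (Solver.solve 6 (λ c a b i o r → c :* a :* (b :* i) :* o :* r := c :* (a :* r) :* (i :* (b :* o)))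
                 refl ⟨ n C toℕ j ⟩ (⟨ w₂ ⟩ ^ toℕ j) (⟨ w₁ ⟩ ^ (n ∸ toℕ j)) ⟨ w₁ ⟩⁻¹
                 (outer (n ∸ toℕ j)) (inner (toℕ j)))) ⟩
        ∑[ j ≤ n ] (⟨ n C toℕ j ⟩ * (⟨ w₂ ⟩ ^ toℕ j * inner (toℕ j))
          * (⟨ w₁ ⟩⁻¹ * (⟨ w₁ ⟩ ^ (n ∸ toℕ j) * outer (n ∸ toℕ j))))
          ≈⟨ binomialConvolution
               (HasEGF-scale {inner} {T ⊗ (G ⊗ e)} ⟨ w₂ ⟩
                 (binomialConvolution
                   (powerSum-HasEGF (ξ ^ᵀ w₂) (w₁ ℕ.* d) {{ℕ.m*n≢0 w₁ d}})
                   (λ _ → refl)))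
               (HasEGF-⊙ ⟨ w₁ ⟩⁻¹ (HasEGF-scale {outer} {(f ⊗ g) ⊗ e′} ⟨ w₁ ⟩ (λ _ → refl)))
               n ⟩
        ⟨ n ! ⟩ * (scale ⟨ w₂ ⟩ (T ⊗ (G ⊗ e)) ⊗ ⟨ w₁ ⟩⁻¹ ⊙ scale ⟨ w₁ ⟩ ((f ⊗ g) ⊗ e′)) n
          ≈⟨ *-congˡ (regroup n) ⟩
        ⟨ n ! ⟩ * sideEGF w₁ w₂ m x y n ∎
        where
        open Solver
        open SetoidReasoning setoid
        f = F χ (ξ ^ᵀ w₁)
        g = pow (F χ (ξ ^ᵀ w₁)) m
        G = pow (F χ (ξ ^ᵀ w₂)) m
        T = sums (ξ ^ᵀ w₂) (w₁ ℕ.* d)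
        e = exp (⟨ w₁ ⟩ * y)
        e′ = exp (⟨ w₂ ⟩ * x)
        inner outer : ℕ → Carrier
        inner j = ∑[ k ≤ j ] (⟨ j C toℕ k ⟩ * powerSum χ (ξ ^ᵀ w₂) (toℕ k) (w₁ ℕ.* d ∸ 1)
          * B χ (ξ ^ᵀ w₂) m (j ∸ toℕ k) (⟨ w₁ ⟩ * y))
        outer k = B χ (ξ ^ᵀ w₁) (suc m) k (⟨ w₂ ⟩ * x)

        α = scaledF w₁
        β = scaledPow m w₁
        γ = scaledPow m w₂
        σ = scaledSums w₁ w₂
        u = exp (⟨ w₂ ⟩ * (⟨ w₁ ⟩ * y))
        v = exp (⟨ w₁ ⟩ * (⟨ w₂ ⟩ * x))

        regroup : scale ⟨ w₂ ⟩ (T ⊗ (G ⊗ e)) ⊗ ⟨ w₁ ⟩⁻¹ ⊙ scale ⟨ w₁ ⟩ (f ⊗ g ⊗ e′)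
          ≋ sideEGF w₁ w₂ m x y
        regroup = S.trans
          (⊗-cong
            (S.trans (scale-cong ⟨ w₂ ⟩ (S.sym (⊗-assoc T G e)))
              (scale-⊗₃ ⟨ w₂ ⟩ T G e (scale-exp ⟨ w₂ ⟩ (⟨ w₁ ⟩ * y))))
            (⊙-cong refl (scale-⊗₃ ⟨ w₁ ⟩ f g e′ (scale-exp ⟨ w₁ ⟩ (⟨ w₂ ⟩ * x)))))
          (S.trans (⊗-⊙ ⟨ w₁ ⟩⁻¹ (σ ⊗ γ ⊗ u) (α ⊗ β ⊗ v))
            (S.trans (⊙-cong refl (⊗-permute α β γ σ u v))
              (S.sym (⊙-⊗ ⟨ w₁ ⟩⁻¹ (α ⊗ σ) (β ⊗ γ ⊗ (v ⊗ u))))))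

      sideEGF-sym : ∀ w₁ w₂ .{{_ : NonZero w₁}} .{{_ : NonZero w₂}} m x y →
        sideEGF w₁ w₂ m x y ≋ sideEGF w₂ w₁ m x y
      sideEGF-sym w₁ w₂ m x y = ⊗-cong key
        (⊗-cong (⊗-comm (scaledPow m w₁) (scaledPow m w₂))
          (⊗-cong (exp-cong (swap x)) (exp-cong (sym (swap y)))))
        where
        open SetoidReasoning setoid
        swap : ∀ z → ⟨ w₁ ⟩ * (⟨ w₂ ⟩ * z) ≈ ⟨ w₂ ⟩ * (⟨ w₁ ⟩ * z)
        swap z = Solver.solve 3 (λ a b z → a :* (b :* z) := b :* (a :* z)) refl ⟨ w₁ ⟩ ⟨ w₂ ⟩ z
          where open Solver
        -- a, b, i, j stand for w₁, w₂ and their inverses.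
        divide-by : ∀ {a b i j} → a * i ≈ 1# → b * j ≈ 1# → ∀ {z z′} → b * z ≈ a * z′ → i * z ≈ j * z′
        divide-by {a} {b} {i} {j} ai bj {z} {z′} eq = begin
          i * z              ≈⟨ *-identityˡ _ ⟨
          1# * (i * z)       ≈⟨ *-congʳ bj ⟨
          b * j * (i * z)    ≈⟨ solve 4 (λ b j i z → b :* j :* (i :* z) := i :* j :* (b :* z)) refl b j i z ⟩
          i * j * (b * z)    ≈⟨ *-congˡ eq ⟩
          i * j * (a * z′)   ≈⟨ solve 4 (λ i j a z → i :* j :* (a :* z) := a :* i :* (j :* z)) refl i j a z′ ⟩
          a * i * (j * z′)   ≈⟨ *-congʳ ai ⟩
          1# * (j * z′)      ≈⟨ *-identityˡ _ ⟩
          j * z′             ∎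
          where open Solver
        key : ⟨ w₁ ⟩⁻¹ ⊙ (scaledF w₁ ⊗ scaledSums w₁ w₂) ≋ ⟨ w₂ ⟩⁻¹ ⊙ (scaledF w₂ ⊗ scaledSums w₂ w₁)
        key n = divide-by (inv-*ʳ (charZero w₁)) (inv-*ʳ (charZero w₂))
          (exchange ⟨ w₁ ⟩ ⟨ w₂ ⟩ {F₁ = F χ (ξ ^ᵀ w₁)} {F χ (ξ ^ᵀ w₂)}
            (t·sums (ξ ^ᵀ w₁) w₂) (t·sums (ξ ^ᵀ w₂) w₁) (scale-E-sym w₁ w₂) n)

theorem1 : ∀ {c ℓ₁ ℓ₂} (p : ℕ) (p-prime : Prime p) (ℂₚ : ℂ[ p ] c ℓ₁ ℓ₂) →
    let open Twisted (ℂ[_].heytingField ℂₚ) (ℂ[_].charZero ℂₚ) p p-prime in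
    (d w₁ w₂ : ℕ) .{{_ : NonZero d}} .{{_ : NonZero w₁}} .{{_ : NonZero w₂}}
    (χ : DirichletCharacter d) (ξ : Tₚ)
    (n m : ℕ) .{{_ : NonZero m}} (x y : Carrier) →
    ∑[ j ≤ n ]
      (⟨ n C toℕ j ⟩ * ⟨ w₂ ⟩ ^ toℕ j * powℤ w₁ (+ n ℤ.- + toℕ j ℤ.- + 1)
        * B χ (ξ ^ᵀ w₁) m (n ∸ toℕ j) (⟨ w₂ ⟩ * x)
        * ∑[ k ≤ toℕ j ]
            (⟨ toℕ j C toℕ k ⟩ * powerSum χ (ξ ^ᵀ w₂) (toℕ k) (w₁ ℕ.* d ∸ 1)
              * B χ (ξ ^ᵀ w₂) (m ∸ 1) (toℕ j ∸ toℕ k) (⟨ w₁ ⟩ * y)))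
    ≈
    ∑[ j ≤ n ]
      (⟨ n C toℕ j ⟩ * ⟨ w₁ ⟩ ^ toℕ j * powℤ w₂ (+ n ℤ.- + toℕ j ℤ.- + 1)
        * B χ (ξ ^ᵀ w₂) m (n ∸ toℕ j) (⟨ w₁ ⟩ * x)
        * ∑[ k ≤ toℕ j ]
            (⟨ toℕ j C toℕ k ⟩ * powerSum χ (ξ ^ᵀ w₁) (toℕ k) (w₂ ℕ.* d ∸ 1)
              * B χ (ξ ^ᵀ w₁) (m ∸ 1) (toℕ j ∸ toℕ k) (⟨ w₂ ⟩ * y)))
theorem1 p p-prime ℂₚ d w₁ w₂ χ ξ n (suc m) x y = trans
  (side-HasEGF χ ξ w₁ w₂ m x y n)
  (trans (*-congˡ (sideEGF-sym χ ξ w₁ w₂ m x y n)) (sym (side-HasEGF χ ξ w₂ w₁ m x y n)))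
  where
  open Twisted (ℂ[_].heytingField ℂₚ) (ℂ[_].charZero ℂₚ) p p-prime
  open SymmetricIdentity (ℂ[_].heytingField ℂₚ) (ℂ[_].charZero ℂₚ) p p-prime
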